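{- There is an absolute constant $C$ such that every finite Sidon set $\mathcal{A}$ with $k$ elements satisfies \[ \operatorname{diam}(\mathcal{A})\ge k^2-1.99058\,k^{3/2}-Ck. \]
   Context: A Sidon set is a set $\mathcal{A}$ of integers such that the only solutions of $a-b=c-d$ with $a,b,c,d\in\mathcal{A}$ are the trivial ones ($a=b,c=d$ or $a=c,b=d$). For a finite set $\mathcal{A}$, $\operatorname{diam}(\mathcal{A})=\max\mathcal{A}-\min\mathcal{A}$. -}

module Defs where

open import Data.Integer using (ℤ; +_; _+_; _-_; _*_; _≤_; _⊔_; _⊓_)
open import Data.List using (List; []; _∷_; foldr)
open import Data.List.Membership.Propositional using (_∈_)
open import Data.Product using (_×_)
open import Data.Sum using (_⊎_)
open import Relation.Binary.PropositionalEquality using (_≡_)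

-- A finite set of integers is represented by a duplicate-free list
-- (the duplicate-freeness is imposed separately in the statement).

IsSidon : List ℤ → Set
IsSidon A = ∀ {a b c d} → a ∈ A → b ∈ A → c ∈ A → d ∈ A →
  a - b ≡ c - d → (a ≡ b × c ≡ d) ⊎ (a ≡ c × b ≡ d)

maxL : List ℤ → ℤ
maxL []       = + 0
maxL (a ∷ as) = foldr _⊔_ a as

minL : List ℤ → ℤ
minL []       = + 0
minL (a ∷ as) = foldr _⊓_ a as

-- diam A = max A - min A  (only used for nonempty A)
diam : List ℤ → ℤ
diam A = maxL A - minL A

-- x ≤ 1.99058 · k^(3/2)  for an integer x and natural k, written without
-- reals: since 1.99058 · k^(3/2) ≥ 0, this holds iff x ≤ 0 or
-- x² ≤ (199058/100000)² · k³, i.e. 100000² · x² ≤ 199058² · k³.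
≤1·99058k^3/2 : ℤ → ℤ → Set
≤1·99058k^3/2 x k =
  (x ≤ + 0) ⊎ (+ 10000000000 * (x * x) ≤ (+ 199058 * + 199058) * (k * k * k))

{-# OPTIONS --safe #-}
module Submission where

-- Write W u x for the number of elements in the window (x − u, x], and put
-- j = ⌊√k / 2⌋, h = kj.  As in the Erdős–Turán argument, the Sidon property
-- bounds ∑ₓ (W u x)², hence the sum S u m of (W u x − m)² over all x; using
-- only S (2h) (2j) ≥ 0 gives n ≥ k² − 2k^(3/2) − O(k).  To gain, note that for
-- x < h every element of (x − 2h, x] lies in (x − h, x], so that
-- W 2h (x + h) = W h (x + h) + W 2h x: these three counts cannot all be close
-- to their means 2j, j, 2j.  The same holds at the right end, and together the
-- two ends force 7 (5 S (2h) (2j) + S h j) ≥ 10 h j².  This yields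
-- k² − n ≤ (585/147) k j + O(k), and 585/147 · j ≤ 585/294 · √k < 1.99058 √k.

open import Defs
open import Data.List using (List; []; _∷_; length; map; foldr)
open import Data.List.Properties using (length-map)
open import Data.List.Membership.Propositional using (_∈_)
open import Data.List.Membership.Propositional.Properties using (∈-map⁺)
open import Data.List.Relation.Unary.All as All using (All; []; _∷_)
open import Data.List.Relation.Unary.AllPairs using ([]; _∷_)
open import Data.List.Relation.Unary.Any using (here; there)
open import Data.List.Relation.Unary.Unique.Propositional using (Unique)
import Data.List.Relation.Unary.Unique.Propositional.Properties as Unique
open import Data.Product using (_×_; _,_; ∃-syntax)
open import Data.Sum using (_⊎_; inj₁; inj₂; [_,_]′)
open import Function using (_∘_)
open import Relation.Binary.PropositionalEquality
open import Relation.Nullary using (yes; no; contradiction)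

module Bounds where

  open import Data.Nat
  open import Data.Nat.Properties
  open import Data.Nat.Tactic.RingSolver using (solve-∀)
  import Data.Integer as ℤ
  open ℤ using (ℤ)
  import Data.Integer.Properties as ℤ
  import Data.Integer.Tactic.RingSolver as ℤSolver

  -- Finite sums over initial segments and over lists.

  ∑ : ℕ → (ℕ → ℕ) → ℕ
  ∑ zero    f = 0
  ∑ (suc n) f = f 0 + ∑ n (f ∘ suc)

  ∑ᴸ : List ℕ → (ℕ → ℕ) → ℕ
  ∑ᴸ []       f = 0
  ∑ᴸ (b ∷ bs) f = f b + ∑ᴸ bs f

  ∑-mono : ∀ n {f g} → (∀ x → x < n → f x ≤ g x) → ∑ n f ≤ ∑ n g
  ∑-mono zero    f≤g = z≤n
  ∑-mono (suc n) f≤g =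
    +-mono-≤ (f≤g 0 z<s) (∑-mono n λ x x<n → f≤g (suc x) (s<s x<n))

  ∑-cong : ∀ n {f g} → (∀ x → x < n → f x ≡ g x) → ∑ n f ≡ ∑ n g
  ∑-cong zero    f≡g = refl
  ∑-cong (suc n) f≡g =
    cong₂ _+_ (f≡g 0 z<s) (∑-cong n λ x x<n → f≡g (suc x) (s<s x<n))

  ∑-const : ∀ n c → ∑ n (λ _ → c) ≡ n * c
  ∑-const zero    c = refl
  ∑-const (suc n) c = cong (c +_) (∑-const n c)

  ∑-0 : ∀ n {f} → (∀ x → x < n → f x ≡ 0) → ∑ n f ≡ 0
  ∑-0 n f≡0 = trans (∑-cong n f≡0) (trans (∑-const n 0) (*-zeroʳ n))

  interchange : ∀ a b c d → a + b + (c + d) ≡ a + c + (b + d)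
  interchange = solve-∀

  ∑-+ : ∀ n f g → ∑ n (λ x → f x + g x) ≡ ∑ n f + ∑ n g
  ∑-+ zero    f g = refl
  ∑-+ (suc n) f g = trans
    (cong (f 0 + g 0 +_) (∑-+ n (f ∘ suc) (g ∘ suc)))
    (interchange (f 0) (g 0) (∑ n (f ∘ suc)) (∑ n (g ∘ suc)))

  ∑-*ˡ : ∀ n c f → ∑ n (λ x → c * f x) ≡ c * ∑ n f
  ∑-*ˡ zero    c f = sym (*-zeroʳ c)
  ∑-*ˡ (suc n) c f = trans
    (cong (c * f 0 +_) (∑-*ˡ n c (f ∘ suc)))
    (sym (*-distribˡ-+ c (f 0) (∑ n (f ∘ suc))))

  ∑-swap : ∀ m n (f : ℕ → ℕ → ℕ) → ∑ m (λ x → ∑ n (f x)) ≡ ∑ n (λ y → ∑ m (λ x → f x y))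
  ∑-swap zero    n f = sym (∑-0 n λ _ _ → refl)
  ∑-swap (suc m) n f = trans
    (cong (∑ n (f 0) +_) (∑-swap m n (f ∘ suc)))
    (sym (∑-+ n (f 0) λ y → ∑ m (λ x → f (suc x) y)))

  ∑-swapᴸ : ∀ n bs (f : ℕ → ℕ → ℕ) → ∑ n (λ x → ∑ᴸ bs (f x)) ≡ ∑ᴸ bs (λ b → ∑ n (λ x → f x b))
  ∑-swapᴸ n []       f = ∑-0 n λ _ _ → refl
  ∑-swapᴸ n (b ∷ bs) f = trans
    (∑-+ n (λ x → f x b) λ x → ∑ᴸ bs (f x))
    (cong (∑ n (λ x → f x b) +_) (∑-swapᴸ n bs f))

  ∑ᴸ-cong : ∀ bs {f g} → (∀ b → f b ≡ g b) → ∑ᴸ bs f ≡ ∑ᴸ bs g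
  ∑ᴸ-cong []       f≡g = refl
  ∑ᴸ-cong (b ∷ bs) f≡g = cong₂ _+_ (f≡g b) (∑ᴸ-cong bs f≡g)

  ∑-split : ∀ m n f → ∑ (m + n) f ≡ ∑ m f + ∑ n (f ∘ (m +_))
  ∑-split zero    n f = refl
  ∑-split (suc m) n f = trans
    (cong (f 0 +_) (∑-split m n (f ∘ suc)))
    (sym (+-assoc (f 0) _ _))

  -- The middle block of `m` terms is dropped, all terms being natural numbers. This isolates the
  -- two ends of the range of window positions.
  ∑-outer : ∀ l m r f → ∑ l f + ∑ r (λ x → f (l + (m + x))) ≤ ∑ (l + (m + r)) f
  ∑-outer l m r f = begin
    ∑ l f + ∑ r (λ x → f (l + (m + x)))
      ≤⟨ +-monoʳ-≤ (∑ l f) (m≤n+m _ (∑ m (λ x → f (l + x)))) ⟩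
    ∑ l f + (∑ m (λ x → f (l + x)) + ∑ r (λ x → f (l + (m + x))))
      ≡⟨ cong (∑ l f +_) (∑-split m r (λ x → f (l + x))) ⟨
    ∑ l f + ∑ (m + r) (λ x → f (l + x))
      ≡⟨ ∑-split l (m + r) f ⟨
    ∑ (l + (m + r)) f ∎
    where open ≤-Reasoning

  -- Sums a pointwise bound of the shape of `edge-inequality` over the `h` positions at one end.
  ∑-edge : ∀ h c a b d → (∀ x → x < h → c ≤ 7 * (5 * (a x + b x) + d x)) →
    h * c ≤ 7 * (5 * (∑ h a + ∑ h b) + ∑ h d)
  ∑-edge h c a b d bound = begin
    h * c                                        ≡⟨ ∑-const h c ⟨
    ∑ h (λ _ → c)                                ≤⟨ ∑-mono h bound ⟩
    ∑ h (λ x → 7 * (5 * (a x + b x) + d x))      ≡⟨ ∑-*ˡ h 7 _ ⟩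
    7 * ∑ h (λ x → 5 * (a x + b x) + d x)        ≡⟨ cong (7 *_) (∑-+ h _ d) ⟩
    7 * (∑ h (λ x → 5 * (a x + b x)) + ∑ h d)    ≡⟨ cong (λ e → 7 * (e + ∑ h d)) (trans (∑-*ˡ h 5 _) (cong (5 *_) (∑-+ h a b))) ⟩
    7 * (5 * (∑ h a + ∑ h b) + ∑ h d)            ∎
    where open ≤-Reasoning

  ∑-product : ∀ n f → ∑ n f * ∑ n f ≡ ∑ n (λ i → ∑ n (λ j → f i * f j))
  ∑-product n f = begin-equality
    ∑ n f * ∑ n f                      ≡⟨ ∑-*ˡ n (∑ n f) f ⟨
    ∑ n (λ i → ∑ n f * f i)            ≡⟨ ∑-cong n (λ i _ → trans (*-comm (∑ n f) (f i)) (sym (∑-*ˡ n (f i) f))) ⟩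
    ∑ n (λ i → ∑ n (λ j → f i * f j))  ∎
    where open ≤-Reasoning

  -- Meant for the positions where two different translates of a Sidon set meet.
  ∑-atMostOne : ∀ n f → (∀ x → f x ≤ 1) →
    (∀ x y → f x ≢ 0 → f y ≢ 0 → x ≡ y) → ∑ n f ≤ 1
  ∑-atMostOne zero    f f≤1 unique = z≤n
  ∑-atMostOne (suc n) f f≤1 unique with f 0 ≟ 0
  ... | yes f0≡0 rewrite f0≡0 =
    ∑-atMostOne n (f ∘ suc) (f≤1 ∘ suc)
      λ x y fx fy → suc-injective (unique (suc x) (suc y) fx fy)
  ... | no  f0≢0 = begin
    f 0 + ∑ n (f ∘ suc)  ≡⟨ cong (f 0 +_) (∑-0 n λ x _ → tail≡0 x) ⟩
    f 0 + 0              ≡⟨ +-identityʳ (f 0) ⟩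
    f 0                  ≤⟨ f≤1 0 ⟩
    1                    ∎
    where
    open ≤-Reasoning
    tail≡0 : ∀ x → f (suc x) ≡ 0
    tail≡0 x with f (suc x) ≟ 0
    ... | yes p = p
    ... | no ¬p = contradiction (unique 0 (suc x) f0≢0 ¬p) λ ()

  -- The Kronecker delta.

  δ : ℕ → ℕ → ℕ
  δ zero    zero    = 1
  δ zero    (suc y) = 0
  δ (suc x) zero    = 0
  δ (suc x) (suc y) = δ x y

  δ-shift : ∀ h x y → δ (h + x) (h + y) ≡ δ x y
  δ-shift zero    x y = refl
  δ-shift (suc h) x y = δ-shift h x y

  δ≢0⇒≡ : ∀ x y → δ x y ≢ 0 → x ≡ y
  δ≢0⇒≡ zero    zero    _ = refl
  δ≢0⇒≡ zero    (suc y) p = contradiction refl p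
  δ≢0⇒≡ (suc x) zero    p = contradiction refl p
  δ≢0⇒≡ (suc x) (suc y) p = cong suc (δ≢0⇒≡ x y p)

  ≢⇒δ≡0 : ∀ x y → x ≢ y → δ x y ≡ 0
  ≢⇒δ≡0 zero    zero    p = contradiction refl p
  ≢⇒δ≡0 zero    (suc y) p = refl
  ≢⇒δ≡0 (suc x) zero    p = refl
  ≢⇒δ≡0 (suc x) (suc y) p = ≢⇒δ≡0 x y (p ∘ cong suc)

  δ-refl : ∀ x → δ x x ≡ 1
  δ-refl zero    = refl
  δ-refl (suc x) = δ-refl x

  δ≤1 : ∀ x y → δ x y ≤ 1
  δ≤1 zero    zero    = ≤-refl
  δ≤1 zero    (suc y) = z≤n
  δ≤1 (suc x) zero    = z≤n
  δ≤1 (suc x) (suc y) = δ≤1 x y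

  ∑-δ : ∀ n c → c < n → ∑ n (δ c) ≡ 1
  ∑-δ (suc n) zero    _         = cong suc (∑-0 n λ _ _ → refl)
  ∑-δ (suc n) (suc c) (s<s c<n) = ∑-δ n c c<n

  ≤1⇒square≤ : ∀ {n} → n ≤ 1 → n * n ≤ n
  ≤1⇒square≤ z≤n       = z≤n
  ≤1⇒square≤ (s≤s z≤n) = ≤-refl

  -- Squared deviations and the edge inequality.

  sq : ℕ → ℕ → ℕ
  sq w m = ∣ w - m ∣ * ∣ w - m ∣

  -- The expansion of (w - m)² with the cross term on the left, so that everything stays in ℕ;
  -- lowering `w` and `m` together leaves `sq` unchanged.
  sq-expand : ∀ w m → sq w m + 2 * m * w ≡ w * w + m * m
  sq-expand zero    m       = trans (cong (m * m +_) (*-zeroʳ (2 * m))) (+-identityʳ _)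
  sq-expand (suc w) zero    = refl
  sq-expand (suc w) (suc m) = begin-equality
    sq w m + 2 * suc m * suc w               ≡⟨ lhs (sq w m) w m ⟩
    (sq w m + 2 * m * w) + 2 * (m + w + 1)   ≡⟨ cong (_+ 2 * (m + w + 1)) (sq-expand w m) ⟩
    (w * w + m * m) + 2 * (m + w + 1)        ≡⟨ rhs w m ⟩
    suc w * suc w + suc m * suc m            ∎
    where
    open ≤-Reasoning
    lhs : ∀ s w m → s + 2 * suc m * suc w ≡ s + 2 * m * w + 2 * (m + w + 1)
    lhs = solve-∀
    rhs : ∀ w m → w * w + m * m + 2 * (m + w + 1) ≡ suc w * suc w + suc m * suc m
    rhs = solve-∀

  ∑-sq : ∀ n f m → ∑ n (λ x → sq (f x) m) + 2 * m * ∑ n f ≡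
                   ∑ n (λ x → f x * f x) + n * (m * m)
  ∑-sq n f m = begin-equality
    ∑ n (λ x → sq (f x) m) + 2 * m * ∑ n f              ≡⟨ cong (∑ n (λ x → sq (f x) m) +_) (∑-*ˡ n (2 * m) f) ⟨
    ∑ n (λ x → sq (f x) m) + ∑ n (λ x → 2 * m * f x)    ≡⟨ ∑-+ n _ _ ⟨
    ∑ n (λ x → sq (f x) m + 2 * m * f x)                ≡⟨ ∑-cong n (λ x _ → sq-expand (f x) m) ⟩
    ∑ n (λ x → f x * f x + m * m)                       ≡⟨ ∑-+ n _ _ ⟩
    ∑ n (λ x → f x * f x) + ∑ n (λ _ → m * m)           ≡⟨ cong (∑ n (λ x → f x * f x) +_) (∑-const n (m * m)) ⟩
    ∑ n (λ x → f x * f x) + n * (m * m)                 ∎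
    where open ≤-Reasoning

  pos-sq : ∀ w m → ℤ.+ sq w m ≡ (ℤ.+ w ℤ.- ℤ.+ m) ℤ.* (ℤ.+ w ℤ.- ℤ.+ m)
  pos-sq w m = begin
    ℤ.+ sq w m                                                ≡⟨ add-sub (ℤ.+ sq w m) (ℤ.+ m) (ℤ.+ w) ⟩
    ℤ.+ sq w m ℤ.+ cross ℤ.- cross                            ≡⟨ cong (λ c → ℤ.+ sq w m ℤ.+ c ℤ.- cross) pos-cross ⟨
    ℤ.+ (sq w m + 2 * m * w) ℤ.- cross                        ≡⟨ cong (λ e → ℤ.+ e ℤ.- cross) (sq-expand w m) ⟩
    ℤ.+ (w * w + m * m) ℤ.- cross                             ≡⟨ cong (ℤ._- cross) (cong₂ ℤ._+_ (ℤ.pos-* w w) (ℤ.pos-* m m)) ⟩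
    ℤ.+ w ℤ.* ℤ.+ w ℤ.+ ℤ.+ m ℤ.* ℤ.+ m ℤ.- cross             ≡⟨ collect (ℤ.+ w) (ℤ.+ m) ⟩
    (ℤ.+ w ℤ.- ℤ.+ m) ℤ.* (ℤ.+ w ℤ.- ℤ.+ m)                   ∎
    where
    open ≡-Reasoning
    cross = ℤ.+ 2 ℤ.* ℤ.+ m ℤ.* ℤ.+ w
    pos-cross : ℤ.+ (2 * m * w) ≡ cross
    pos-cross = trans (ℤ.pos-* (2 * m) w) (cong (ℤ._* ℤ.+ w) (ℤ.pos-* 2 m))
    add-sub : ∀ s m w → s ≡ s ℤ.+ ℤ.+ 2 ℤ.* m ℤ.* w ℤ.- ℤ.+ 2 ℤ.* m ℤ.* w
    add-sub = ℤSolver.solve-∀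
    collect : ∀ w m → w ℤ.* w ℤ.+ m ℤ.* m ℤ.- ℤ.+ 2 ℤ.* m ℤ.* w ≡ (w ℤ.- m) ℤ.* (w ℤ.- m)
    collect = ℤSolver.solve-∀

  square-nonneg : ∀ i → ℤ.+ 0 ℤ.≤ i ℤ.* i
  square-nonneg (ℤ.+ n)      = subst (ℤ.+ 0 ℤ.≤_) (ℤ.pos-* n n) (ℤ.+≤+ z≤n)
  square-nonneg (ℤ.-[1+ n ]) = ℤ.+≤+ z≤n

  -- Cauchy–Schwarz for p − q + r = −j, where p, q, r are the deviations of the
  -- three window counts from 2j, 2j, j; the remainder is given by Lagrange's identity.
  edge-inequality : ∀ P R j → 5 * (j * j) ≤
    7 * (5 * (sq P (2 * j) + sq (R + P) (2 * j)) + sq R j)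
  edge-inequality P R j = ℤ.drop‿+≤+ (begin
    ℤ.+ (5 * (j * j))                                   ≡⟨ pos-lhs ⟩
    ℤ.+ 5 ℤ.* (j′ ℤ.* j′)                               ≡⟨ ℤ.+-identityʳ _ ⟨
    ℤ.+ 5 ℤ.* (j′ ℤ.* j′) ℤ.+ ℤ.+ 0                     ≤⟨ ℤ.+-monoʳ-≤ (ℤ.+ 5 ℤ.* (j′ ℤ.* j′)) squares≥0 ⟩
    ℤ.+ 5 ℤ.* (j′ ℤ.* j′) ℤ.+ squares                   ≡⟨ lagrange (ℤ.+ P) (ℤ.+ R) j′ ⟩
    ℤ.+ 7 ℤ.* (ℤ.+ 5 ℤ.* (p ℤ.* p ℤ.+ q ℤ.* q) ℤ.+ r ℤ.* r)  ≡⟨ pos-rhs ⟨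
    ℤ.+ (7 * (5 * (sq P (2 * j) + sq (R + P) (2 * j)) + sq R j)) ∎)
    where
    open ℤ.≤-Reasoning
    j′ = ℤ.+ j
    p = ℤ.+ P ℤ.- ℤ.+ 2 ℤ.* j′
    q = ℤ.+ R ℤ.+ ℤ.+ P ℤ.- ℤ.+ 2 ℤ.* j′
    r = ℤ.+ R ℤ.- j′
    -- Lagrange's identity for p, -q, r with weights 5, 5, 1: one square for each pair. The factor 7
    -- is 5 (1/5 + 1/5 + 1).
    t₁ = p ℤ.+ q
    t₂ = r ℤ.- ℤ.+ 5 ℤ.* p
    t₃ = r ℤ.+ ℤ.+ 5 ℤ.* q
    squares = ℤ.+ 5 ℤ.* (t₁ ℤ.* t₁) ℤ.+ t₂ ℤ.* t₂ ℤ.+ t₃ ℤ.* t₃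
    squares≥0 : ℤ.+ 0 ℤ.≤ squares
    squares≥0 = ℤ.+-mono-≤ (ℤ.+-mono-≤ (ℤ.*-monoˡ-≤-nonNeg (ℤ.+ 5) (square-nonneg t₁)) (square-nonneg t₂)) (square-nonneg t₃)
    pos-lhs : ℤ.+ (5 * (j * j)) ≡ ℤ.+ 5 ℤ.* (j′ ℤ.* j′)
    pos-lhs = trans (ℤ.pos-* 5 (j * j)) (cong (ℤ.+ 5 ℤ.*_) (ℤ.pos-* j j))
    pos-sq₂ : ∀ w → ℤ.+ sq w (2 * j) ≡ (ℤ.+ w ℤ.- ℤ.+ 2 ℤ.* j′) ℤ.* (ℤ.+ w ℤ.- ℤ.+ 2 ℤ.* j′)
    pos-sq₂ w = trans (pos-sq w (2 * j)) (cong (λ m → (ℤ.+ w ℤ.- m) ℤ.* (ℤ.+ w ℤ.- m)) (ℤ.pos-* 2 j))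
    pos-rhs : ℤ.+ (7 * (5 * (sq P (2 * j) + sq (R + P) (2 * j)) + sq R j)) ≡
              ℤ.+ 7 ℤ.* (ℤ.+ 5 ℤ.* (p ℤ.* p ℤ.+ q ℤ.* q) ℤ.+ r ℤ.* r)
    pos-rhs = trans (ℤ.pos-* 7 (5 * (sq P (2 * j) + sq (R + P) (2 * j)) + sq R j)) (cong (ℤ.+ 7 ℤ.*_) (cong₂ ℤ._+_
      (trans (ℤ.pos-* 5 (sq P (2 * j) + sq (R + P) (2 * j))) (cong (ℤ.+ 5 ℤ.*_) (cong₂ ℤ._+_ (pos-sq₂ P) (pos-sq₂ (R + P)))))
      (pos-sq R j)))
    lagrange : ∀ P R j →
      let p = P ℤ.- ℤ.+ 2 ℤ.* j; q = R ℤ.+ P ℤ.- ℤ.+ 2 ℤ.* j; r = R ℤ.- j in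
      ℤ.+ 5 ℤ.* (j ℤ.* j) ℤ.+
        (ℤ.+ 5 ℤ.* ((p ℤ.+ q) ℤ.* (p ℤ.+ q))
          ℤ.+ (r ℤ.- ℤ.+ 5 ℤ.* p) ℤ.* (r ℤ.- ℤ.+ 5 ℤ.* p)
          ℤ.+ (r ℤ.+ ℤ.+ 5 ℤ.* q) ℤ.* (r ℤ.+ ℤ.+ 5 ℤ.* q))
      ≡ ℤ.+ 7 ℤ.* (ℤ.+ 5 ℤ.* (p ℤ.* p ℤ.+ q ℤ.* q) ℤ.+ r ℤ.* r)
    lagrange = ℤSolver.solve-∀

  -- Counting in duplicate-free lists.

  ∑ᴸ≢0 : ∀ bs f → ∑ᴸ bs f ≢ 0 → ∃[ b ] b ∈ bs × f b ≢ 0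
  ∑ᴸ≢0 []       f p = contradiction refl p
  ∑ᴸ≢0 (b ∷ bs) f p with f b ≟ 0
  ... | no  fb≢0 = b , here refl , fb≢0
  ... | yes fb≡0 rewrite fb≡0 with ∑ᴸ≢0 bs f p
  ...   | c , c∈bs , fc≢0 = c , there c∈bs , fc≢0

  ∑ᴸ-0 : ∀ bs f → (∀ {b} → b ∈ bs → f b ≡ 0) → ∑ᴸ bs f ≡ 0
  ∑ᴸ-0 []       f f≡0 = refl
  ∑ᴸ-0 (b ∷ bs) f f≡0 = cong₂ _+_ (f≡0 (here refl)) (∑ᴸ-0 bs f (f≡0 ∘ there))

  ∑ᴸ-1 : ∀ bs f → (∀ {b} → b ∈ bs → f b ≡ 1) → ∑ᴸ bs f ≡ length bs
  ∑ᴸ-1 []       f f≡1 = refl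
  ∑ᴸ-1 (b ∷ bs) f f≡1 = cong₂ _+_ (f≡1 (here refl)) (∑ᴸ-1 bs f (f≡1 ∘ there))

  -- Once some `b` satisfies `i + b ≡ x`, cancelling `i` shows that a second hit would repeat `b`,
  -- against `Unique`.
  ∑ᴸ-δ≤1 : ∀ {bs} → Unique bs → ∀ i x → ∑ᴸ bs (λ b → δ (i + b) x) ≤ 1
  ∑ᴸ-δ≤1 []                             i x = z≤n
  ∑ᴸ-δ≤1 {b ∷ bs} (b≢bs ∷ bs-unique) i x with i + b ≟ x
  ... | no  i+b≢x rewrite ≢⇒δ≡0 (i + b) x i+b≢x = ∑ᴸ-δ≤1 bs-unique i x
  ... | yes refl = begin
    δ (i + b) (i + b) + ∑ᴸ bs (λ c → δ (i + c) (i + b))  ≡⟨ cong₂ _+_ (δ-refl (i + b)) (∑ᴸ-0 bs _ tail≡0) ⟩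
    1                                                    ∎
    where
    open ≤-Reasoning
    tail≡0 : ∀ {c} → c ∈ bs → δ (i + c) (i + b) ≡ 0
    tail≡0 {c} c∈bs = ≢⇒δ≡0 _ _ λ eq →
      All.lookup b≢bs c∈bs (sym (+-cancelˡ-≡ i c b eq))

  -- The equation a - b = c - d is written additively, which avoids truncated subtraction.
  IsSidonℕ : List ℕ → Set
  IsSidonℕ B = ∀ {a b c d} → a ∈ B → b ∈ B → c ∈ B → d ∈ B →
    a + d ≡ c + b → (a ≡ b × c ≡ d) ⊎ (a ≡ c × b ≡ d)

  -- Window counts and their first two moments.

  module Windows (B : List ℕ) where

    -- Indexed so that W u x is the number of elements of B in (x − u, x].
    χ : ℕ → ℕ → ℕ
    χ i x = ∑ᴸ B (λ b → δ (i + b) x)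

    W : ℕ → ℕ → ℕ
    W u x = ∑ u (λ i → χ i x)

    k : ℕ
    k = length B

    χ-shift : ∀ h i x → χ (h + i) (h + x) ≡ χ i x
    χ-shift h i x = ∑ᴸ-cong B λ b → trans
      (cong (λ c → δ c (h + x)) (+-assoc h i b)) (δ-shift h (i + b) x)

    χ≢0 : ∀ i x → χ i x ≢ 0 → ∃[ b ] b ∈ B × i + b ≡ x
    χ≢0 i x p with ∑ᴸ≢0 B (λ b → δ (i + b) x) p
    ... | b , b∈B , δ≢0 = b , b∈B , δ≢0⇒≡ (i + b) x δ≢0

    χ≡0 : ∀ i x → (∀ {b} → b ∈ B → i + b ≢ x) → χ i x ≡ 0
    χ≡0 i x p = ∑ᴸ-0 B _ λ {b} b∈B → ≢⇒δ≡0 (i + b) x (p b∈B)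

    -- The window is cut in half, and `χ-shift` turns the offsets from `h` on into a window ending
    -- at `x`.
    W-double : ∀ h x → W (h + h) (h + x) ≡ W h (h + x) + W h x
    W-double h x = trans
      (∑-split h h (λ i → χ i (h + x)))
      (cong (W h (h + x) +_) (∑-cong h λ i _ → χ-shift h i x))

    -- For `x < h` the far half (x - 2h, x - h] contains only negative numbers, hence nothing from
    -- `B`.
    W-double-left : ∀ h x → x < h → W (h + h) x ≡ W h x
    W-double-left h x x<h = trans
      (∑-split h h (λ i → χ i x))
      (trans (cong (W h x +_) (∑-0 h λ i _ → χ≡0 (h + i) x λ {b} _ eq →
               <⇒≢ (<-≤-trans x<h (≤-trans (m≤m+n h i) (m≤m+n (h + i) b))) (sym eq)))
             (+-identityʳ _))

    module _ {n} (B≤n : ∀ {b} → b ∈ B → b ≤ n) where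

      -- This window is (n + y, u + n + y], beyond every element of `B`.
      W-right : ∀ u y → W u (u + (n + y)) ≡ 0
      W-right u y = ∑-0 u λ i i<u → χ≡0 i _ λ {b} b∈B eq →
        <⇒≢ (<-≤-trans (+-mono-<-≤ i<u (B≤n b∈B)) (+-monoʳ-≤ u (m≤m+n n y))) eq

      -- Each `b` is counted once, at `x = i + b`, which is below `n + u` because `i < u` and
      -- `b ≤ n`.
      ∑-χ : ∀ {u i} → i < u → ∑ (n + u) (χ i) ≡ k
      ∑-χ {u} {i} i<u = trans
        (∑-swapᴸ (n + u) B (λ x b → δ (i + b) x))
        (∑ᴸ-1 B _ λ {b} b∈B → ∑-δ (n + u) (i + b)
          (subst (i + b <_) (+-comm u n) (+-mono-<-≤ i<u (B≤n b∈B))))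

      ∑-W : ∀ u → ∑ (n + u) (W u) ≡ u * k
      ∑-W u = begin-equality
        ∑ (n + u) (λ x → ∑ u (λ i → χ i x))  ≡⟨ ∑-swap (n + u) u (λ x i → χ i x) ⟩
        ∑ u (λ i → ∑ (n + u) (χ i))          ≡⟨ ∑-cong u (λ i i<u → ∑-χ i<u) ⟩
        ∑ u (λ _ → k)                        ≡⟨ ∑-const u k ⟩
        u * k                                ∎
        where open ≤-Reasoning

      module _ (B-unique : Unique B) (B-sidon : IsSidonℕ B) where

        -- If x = i + a = j + b and y = i + c = j + d, then a - b = j - i = c - d. The Sidon
        -- alternative a = b would give i = j, so a = c and x = y.
        pair-unique : ∀ {i j} → i ≢ j → ∀ x y →
          χ i x * χ j x ≢ 0 → χ i y * χ j y ≢ 0 → x ≡ y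
        pair-unique {i} {j} i≢j x y px py
          with χ≢0 i x (px ∘ cong (_* χ j x))
             | χ≢0 j x (λ e → px (trans (cong (χ i x *_) e) (*-zeroʳ (χ i x))))
             | χ≢0 i y (py ∘ cong (_* χ j y))
             | χ≢0 j y (λ e → py (trans (cong (χ i y *_) e) (*-zeroʳ (χ i y))))
        ... | a , a∈B , refl | b , b∈B , j+b≡x | c , c∈B , refl | d , d∈B , j+d≡y
          with B-sidon a∈B b∈B c∈B d∈B (+-cancelˡ-≡ (i + j) (a + d) (c + b) (begin-equality
            i + j + (a + d)    ≡⟨ interchange i j a d ⟩
            i + a + (j + d)    ≡⟨ cong₂ _+_ (sym j+b≡x) j+d≡y ⟩
            j + b + (i + c)    ≡⟨ +-comm (j + b) (i + c) ⟩
            i + c + (j + b)    ≡⟨ interchange i j c b ⟨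
            i + j + (c + b)    ∎))
          where open ≤-Reasoning
        ...   | inj₁ (refl , _) = contradiction (sym (+-cancelʳ-≡ a j i j+b≡x)) i≢j
        ...   | inj₂ (refl , _) = refl

        -- Equal offsets give the size of `B`; different offsets meet at most once by `pair-unique`.
        -- Allowing 1 on the diagonal too keeps the bound uniform and costs only `u` in `∑-W²`.
        ∑-χχ : ∀ {u} i j → i < u → ∑ (n + u) (λ x → χ i x * χ j x) ≤ δ i j * k + 1
        ∑-χχ {u} i j i<u with i ≟ j
        ... | yes refl rewrite δ-refl i = begin
          ∑ (n + u) (λ x → χ i x * χ i x)  ≤⟨ ∑-mono (n + u) (λ x _ → ≤1⇒square≤ (∑ᴸ-δ≤1 B-unique i x)) ⟩
          ∑ (n + u) (χ i)                  ≡⟨ ∑-χ i<u ⟩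
          k                                ≤⟨ ≤-trans (m≤m+n k 0) (m≤m+n (k + 0) 1) ⟩
          k + 0 + 1                        ∎
          where open ≤-Reasoning
        ... | no i≢j rewrite ≢⇒δ≡0 i j i≢j = ∑-atMostOne (n + u) _
          (λ x → *-mono-≤ (∑ᴸ-δ≤1 B-unique i x) (∑ᴸ-δ≤1 B-unique j x))
          (pair-unique i≢j)

        -- The Erdős-Turán second moment: the square becomes a double sum over offsets, and each row
        -- of correlations contributes at most `k + u`.
        ∑-W² : ∀ u → ∑ (n + u) (λ x → W u x * W u x) ≤ u * (k + u)
        ∑-W² u = begin
          ∑ (n + u) (λ x → W u x * W u x)
            ≡⟨ ∑-cong (n + u) (λ x _ → ∑-product u (λ i → χ i x)) ⟩
          ∑ (n + u) (λ x → ∑ u (λ i → ∑ u (λ j → χ i x * χ j x)))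
            ≡⟨ ∑-swap (n + u) u _ ⟩
          ∑ u (λ i → ∑ (n + u) (λ x → ∑ u (λ j → χ i x * χ j x)))
            ≡⟨ ∑-cong u (λ i _ → ∑-swap (n + u) u _) ⟩
          ∑ u (λ i → ∑ u (λ j → ∑ (n + u) (λ x → χ i x * χ j x)))
            ≤⟨ ∑-mono u (λ i i<u → ∑-mono u λ j _ → ∑-χχ i j i<u) ⟩
          ∑ u (λ i → ∑ u (λ j → δ i j * k + 1))
            ≡⟨ ∑-cong u (λ i i<u → row i i<u) ⟩
          ∑ u (λ _ → k + u)
            ≡⟨ ∑-const u (k + u) ⟩
          u * (k + u) ∎
          where
          open ≤-Reasoning
          row : ∀ i → i < u → ∑ u (λ j → δ i j * k + 1) ≡ k + u
          row i i<u = begin-equality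
            ∑ u (λ j → δ i j * k + 1)                  ≡⟨ ∑-+ u _ _ ⟩
            ∑ u (λ j → δ i j * k) + ∑ u (λ _ → 1)      ≡⟨ cong₂ _+_ (∑-cong u λ j _ → *-comm (δ i j) k) (∑-const u 1) ⟩
            ∑ u (λ j → k * δ i j) + u * 1              ≡⟨ cong₂ _+_ (∑-*ˡ u k (δ i)) (*-identityʳ u) ⟩
            k * ∑ u (δ i) + u                          ≡⟨ cong (λ e → k * e + u) (∑-δ u i i<u) ⟩
            k * 1 + u                                  ≡⟨ cong (_+ u) (*-identityʳ k) ⟩
            k + u                                      ∎

        -- Total squared deviation, bounded above and below.

        -- The range `n + u` consists of exactly those `x` whose window (x - u, x] meets [0, n].
        S : ℕ → ℕ → ℕ
        S u m = ∑ (n + u) (λ x → sq (W u x) m)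

        S-upper : ∀ u m → S u m + 2 * m * (u * k) ≤ u * (k + u) + (n + u) * (m * m)
        S-upper u m = begin
          S u m + 2 * m * (u * k)                ≡⟨ cong (λ e → S u m + 2 * m * e) (∑-W u) ⟨
          S u m + 2 * m * ∑ (n + u) (W u)        ≡⟨ ∑-sq (n + u) (W u) m ⟩
          ∑ (n + u) (λ x → W u x * W u x) + (n + u) * (m * m)
                                                 ≤⟨ +-monoˡ-≤ _ (∑-W² u) ⟩
          u * (k + u) + (n + u) * (m * m)        ∎
          where open ≤-Reasoning

        -- `edge-inequality` is applied at `h` positions at each end. Since n ≥ 3h, no deviation is
        -- used twice, so the sum of all those used is at most the full one.
        S-lower : ∀ h e j → n ≡ 3 * h + e →
          10 * h * (j * j) ≤ 7 * (5 * S (h + h) (2 * j) + S h j)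
        S-lower h e j n≡ = begin
          10 * h * (j * j)
            ≡⟨ halve h j ⟩
          h * (5 * (j * j)) + h * (5 * (j * j))
            ≤⟨ +-mono-≤ (∑-edge h _ _ _ _ left) (∑-edge h _ _ _ _ right) ⟩
          7 * (5 * (a + b) + p) + 7 * (5 * (c + d) + q)
            ≡⟨ regroup a b c d p q ⟩
          7 * (5 * ((a + b) + (c + d)) + (p + q))
            ≤⟨ *-monoʳ-≤ 7 (+-mono-≤ (*-monoʳ-≤ 5 blocks₂) blocks₁) ⟩
          7 * (5 * S (h + h) (2 * j) + S h j) ∎
          where
          open ≤-Reasoning
          f g : ℕ → ℕ
          f x = sq (W (h + h) x) (2 * j)
          g x = sq (W h x) j
          -- Here `z x` is n - h + x, so it runs over the last `h` positions before `n`.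
          z : ℕ → ℕ
          z x = h + (h + (e + x))
          a = ∑ h f
          b = ∑ h (λ x → f (h + x))
          c = ∑ h (λ x → f (h + (h + z x)))
          d = ∑ h (λ x → f (h + z x))
          p = ∑ h (λ x → g (h + x))
          q = ∑ h (λ x → g (z x))

          halve : ∀ h j → 10 * h * (j * j) ≡ h * (5 * (j * j)) + h * (5 * (j * j))
          halve = solve-∀
          regroup : ∀ a b c d p q → 7 * (5 * (a + b) + p) + 7 * (5 * (c + d) + q) ≡
                    7 * (5 * ((a + b) + (c + d)) + (p + q))
          regroup = solve-∀

          left : ∀ x → x < h → 5 * (j * j) ≤ 7 * (5 * (f x + f (h + x)) + g (h + x))
          left x x<h rewrite W-double-left h x x<h | W-double h x =
            edge-inequality (W h x) (W h (h + x)) j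

          n+x≡h+z : ∀ x → n + x ≡ h + z x
          n+x≡h+z x = trans (cong (_+ x) n≡) (reassoc h e x)
            where
            reassoc : ∀ h e x → 3 * h + e + x ≡ h + (h + (h + (e + x)))
            reassoc = solve-∀

          right : ∀ x → x < h →
            5 * (j * j) ≤ 7 * (5 * (f (h + (h + z x)) + f (h + z x)) + g (z x))
          -- The mirror image of the left end: the upper half of the window ending at n + h + x is
          -- empty by `W-right`, so its count equals that of the length-h window ending at n + x.
          right x _ rewrite W-double h (h + z x) | W-double h (z x)
            | trans (cong (λ y → W h (h + y)) (sym (n+x≡h+z x))) (W-right h x)
            | +-comm (W h (h + z x)) (W h (z x)) =
            edge-inequality (W h (h + z x)) (W h (z x)) j

          -- The sums `a`, `b` cover [0, 2h) and `d`, `c`, in this order, cover [n, n + 2h); the gap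
          -- between them is h + e.
          blocks₂ : (a + b) + (c + d) ≤ S (h + h) (2 * j)
          blocks₂ = begin
            (a + b) + (c + d)
              ≡⟨ cong₂ _+_ (sym (∑-split h h f)) (trans (+-comm c d)
                   (cong₂ _+_ (∑-cong h λ x _ → cong f (reassoc₁ h e x))
                              (∑-cong h λ x _ → cong f (reassoc₂ h e x)))) ⟩
            ∑ (h + h) f + (∑ h (λ x → f (h + h + (h + e + x))) + ∑ h (λ x → f (h + h + (h + e + (h + x)))))
              ≡⟨ cong (∑ (h + h) f +_) (∑-split h h (λ x → f (h + h + (h + e + x)))) ⟨
            ∑ (h + h) f + ∑ (h + h) (λ x → f (h + h + (h + e + x)))
              ≤⟨ ∑-outer (h + h) (h + e) (h + h) f ⟩
            ∑ (h + h + (h + e + (h + h))) f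
              ≡⟨ cong (λ N → ∑ N f) (trans (reassoc₃ h e) (cong (_+ (h + h)) (sym n≡))) ⟩
            ∑ (n + (h + h)) f ∎
            where
            reassoc₁ : ∀ h e x → h + (h + (h + (e + x))) ≡ h + h + (h + e + x)
            reassoc₁ = solve-∀
            reassoc₂ : ∀ h e x → h + (h + (h + (h + (e + x)))) ≡ h + h + (h + e + (h + x))
            reassoc₂ = solve-∀
            reassoc₃ : ∀ h e → h + h + (h + e + (h + h)) ≡ 3 * h + e + (h + h)
            reassoc₃ = solve-∀

          -- The sums cover [h, 2h) and [n - h, n), separated by a gap of exactly `e`: here n ≥ 3h
          -- is sharp.
          blocks₁ : p + q ≤ S h j
          blocks₁ = begin
            p + q
              ≤⟨ ∑-outer h e h (λ x → g (h + x)) ⟩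
            ∑ (h + (e + h)) (λ x → g (h + x))
              ≤⟨ m≤n+m _ (∑ h g) ⟩
            ∑ h g + ∑ (h + (e + h)) (λ x → g (h + x))
              ≡⟨ ∑-split h (h + (e + h)) g ⟨
            ∑ (h + (h + (e + h))) g
              ≤⟨ m≤m+n _ _ ⟩
            ∑ (h + (h + (e + h))) g + ∑ h (λ x → g (h + (h + (e + h)) + x))
              ≡⟨ ∑-split (h + (h + (e + h))) h g ⟨
            ∑ (h + (h + (e + h)) + h) g
              ≡⟨ cong (λ N → ∑ N g) (trans (reassoc h e) (cong (_+ h) (sym n≡))) ⟩
            ∑ (n + h) g ∎
            where
            reassoc : ∀ h e → h + (h + (e + h)) + h ≡ 3 * h + e + h
            reassoc = solve-∀

        -- Take h = kj and add 35 times `S-upper` for (2h, 2j) to 7 times `S-upper` for (h, j), the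
        -- weights in `S-lower`. The deviations drop out, and a factor `j` is cancelled.
        diameter-bound : ∀ j .{{_ : NonZero j}} → 3 * (k * j) ≤ n →
          147 * (k * k * j) ≤ 77 * (k * k) + 147 * (n * j) + 277 * (k * (j * j))
        diameter-bound j 3h≤n = *-cancelˡ-≤ j (+-cancelˡ-≤ extra _ _ (begin
          extra + j * (147 * (k * k * j))
            ≡⟨ lower-form k j ⟩
          10 * h * (j * j) + X
            ≤⟨ +-monoˡ-≤ X (S-lower h (n ∸ 3 * h) j (sym (m+[n∸m]≡n 3h≤n))) ⟩
          7 * (5 * S₂ + S₁) + X
            ≡⟨ regroup S₂ S₁ k h j ⟩
          35 * (S₂ + 2 * (2 * j) * ((h + h) * k)) + 7 * (S₁ + 2 * j * (h * k))
            ≤⟨ +-mono-≤ (*-monoʳ-≤ 35 (S-upper (h + h) (2 * j))) (*-monoʳ-≤ 7 (S-upper h j)) ⟩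
          35 * ((h + h) * (k + (h + h)) + (n + (h + h)) * (2 * j * (2 * j)))
            + 7 * (h * (k + h) + (n + h) * (j * j))
            ≡⟨ upper-form n k j ⟩
          extra + j * (77 * (k * k) + 147 * (n * j) + 277 * (k * (j * j))) ∎))
          where
          open ≤-Reasoning
          h = k * j
          -- Collects the terms common to both sides, so that they are cancelled instead of
          -- subtracted.
          extra = 10 * (k * (j * j * j)) + 147 * (k * k * (j * j))
          X = 294 * (j * h * k)
          S₂ = S (h + h) (2 * j)
          S₁ = S h j
          lower-form : ∀ k j →
            10 * (k * (j * j * j)) + 147 * (k * k * (j * j)) + j * (147 * (k * k * j)) ≡
            10 * (k * j) * (j * j) + 294 * (j * (k * j) * k)
          lower-form = solve-∀
          regroup : ∀ S₂ S₁ k h j → 7 * (5 * S₂ + S₁) + 294 * (j * h * k) ≡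
            35 * (S₂ + 2 * (2 * j) * ((h + h) * k)) + 7 * (S₁ + 2 * j * (h * k))
          regroup = solve-∀
          upper-form : ∀ n k j →
            35 * ((k * j + k * j) * (k + (k * j + k * j)) + (n + (k * j + k * j)) * (2 * j * (2 * j)))
              + 7 * (k * j * (k + k * j) + (n + k * j) * (j * j)) ≡
            10 * (k * (j * j * j)) + 147 * (k * k * (j * j))
              + j * (77 * (k * k) + 147 * (n * j) + 277 * (k * (j * j)))
          upper-form = solve-∀

  -- Choice of j and numerical steps.

  -- This `j` is ⌊√k / 2⌋; the upper end is 4(j + 1)² - 1, and `j` grows when `k` passes it.
  half-sqrt : ∀ k → ∃[ j ] 4 * (j * j) ≤ k × k ≤ 4 * (j * j) + 8 * j + 3
  half-sqrt zero = 0 , z≤n , z≤n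
  half-sqrt (suc k) with half-sqrt k
  ... | j , lo , hi with k ≟ 4 * (j * j) + 8 * j + 3
  ...   | no  k≢ = j , m≤n⇒m≤1+n lo , ≤∧≢⇒< hi k≢
  ...   | yes refl = suc j , ≤-reflexive (next j) ,
    ≤-trans (≤-reflexive (sym (next j))) (≤-trans (m≤m+n _ (8 * suc j)) (m≤m+n _ 3))
    where
    next : ∀ j → 4 * (suc j * suc j) ≡ suc (4 * (j * j) + 8 * j + 3)
    next = solve-∀

  -- The numerical constants are abstracted in the next two lemmas because
  -- comparing products of large literals during conversion unfolds them in unary.
  linear-step : ∀ a b c d t .{{_ : NonZero a}} {y} → c * b ≤ a * (d * 2) →
    a * y ≤ b * t → c * y ≤ d * (2 * t)
  linear-step a b c d t {y} cb≤ ay≤bt = *-cancelˡ-≤ a (begin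
    a * (c * y)            ≡⟨ swap a c y ⟩
    c * (a * y)            ≤⟨ *-monoʳ-≤ c ay≤bt ⟩
    c * (b * t)            ≡⟨ *-assoc c b t ⟨
    c * b * t              ≤⟨ *-monoˡ-≤ t cb≤ ⟩
    a * (d * 2) * t        ≡⟨ assoc a d t ⟩
    a * (d * (2 * t))      ∎)
    where
    open ≤-Reasoning
    swap : ∀ c d y → c * (d * y) ≡ d * (c * y)
    swap = solve-∀
    assoc : ∀ a d t → a * (d * 2) * t ≡ a * (d * (2 * t))
    assoc = solve-∀

  square-step : ∀ k j c d {C y} → C ≡ c * c → 4 * (j * j) ≤ k →
    c * y ≤ d * (2 * (k * j)) → C * (y * y) ≤ d * d * (k * k * k)
  square-step k j c d {y = y} refl ≤k linear = begin
    c * c * (y * y)                            ≡⟨ square₁ c y ⟩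
    c * y * (c * y)                            ≤⟨ *-mono-≤ linear linear ⟩
    d * (2 * (k * j)) * (d * (2 * (k * j)))    ≡⟨ square₂ d k j ⟩
    d * d * (k * k * (4 * (j * j)))            ≤⟨ *-monoʳ-≤ (d * d) (*-monoʳ-≤ (k * k) ≤k) ⟩
    d * d * (k * k * k)                        ∎
    where
    open ≤-Reasoning
    square₁ : ∀ c y → c * c * (y * y) ≡ c * y * (c * y)
    square₁ = solve-∀
    square₂ : ∀ c k j → c * (2 * (k * j)) * (c * (2 * (k * j))) ≡ c * c * (k * k * (4 * (j * j)))
    square₂ = solve-∀

  0-bound : ∀ c {y t} → y ≡ 0 → c * y ≤ t
  0-bound c refl = ≤-trans (≤-reflexive (*-zeroʳ c)) z≤n

  -- Bounding k² - n for Sidon sets in [0, n].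

  module _ (B : List ℕ) (B-unique : Unique B) (B-sidon : IsSidonℕ B) where
    open Windows B

    -- One factor `k` of 77k² is replaced by 4j² + 11j, valid as j ≥ 1, and `j` is cancelled: 585 =
    -- 77 · 4 + 277 and 847 = 77 · 11.
    quadratic-bound : ∀ {n} j .{{_ : NonZero j}} → (∀ {b} → b ∈ B → b ≤ n) →
      k ≤ 4 * (j * j) + 8 * j + 3 → 3 * (k * j) ≤ n →
      147 * (k * k) ≤ 147 * n + (585 * (k * j) + 847 * k)
    quadratic-bound {n} j B≤n k≤ 3h≤n = *-cancelˡ-≤ j (begin
      j * (147 * (k * k))
        ≡⟨ rearrange₁ k j ⟩
      147 * (k * k * j)
        ≤⟨ diameter-bound B≤n B-unique B-sidon j 3h≤n ⟩
      77 * (k * k) + 147 * (n * j) + 277 * (k * (j * j))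
        ≤⟨ +-monoˡ-≤ _ (+-monoˡ-≤ _ (*-monoʳ-≤ 77 (*-monoʳ-≤ k k≤′))) ⟩
      77 * (k * (4 * (j * j) + 8 * j + 3 * j)) + 147 * (n * j) + 277 * (k * (j * j))
        ≡⟨ rearrange₂ n k j ⟩
      j * (147 * n + (585 * (k * j) + 847 * k)) ∎)
      where
      open ≤-Reasoning
      k≤′ : k ≤ 4 * (j * j) + 8 * j + 3 * j
      k≤′ = ≤-trans k≤ (+-monoʳ-≤ (4 * (j * j) + 8 * j) (m≤m*n 3 j))
      rearrange₁ : ∀ k j → j * (147 * (k * k)) ≡ 147 * (k * k * j)
      rearrange₁ = solve-∀
      rearrange₂ : ∀ n k j →
        77 * (k * (4 * (j * j) + 8 * j + 3 * j)) + 147 * (n * j) + 277 * (k * (j * j)) ≡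
        j * (147 * n + (585 * (k * j) + 847 * k))
      rearrange₂ = solve-∀

    -- A set inside [0, n] also lies in [0, 3kj], where `quadratic-bound` applies. It gives 147k ≤
    -- 1026j + 847, which fails for large `k` because `j` is only of order √k.
    small-diameter⇒k≤23 : ∀ {n} j .{{_ : NonZero j}} → (∀ {b} → b ∈ B → b ≤ n) →
      4 * (j * j) ≤ k → k ≤ 4 * (j * j) + 8 * j + 3 → n ≤ 3 * (k * j) → 1 ≤ k → k ≤ 23
    small-diameter⇒k≤23 j B≤n ≤k k≤ n≤3h 1≤k = ≤-pred (*-cancelˡ-< 82 k 24
      (≤-<-trans 82k≤1887 (<ᵇ⇒< 1887 (82 * 24) _)))
      where
      open ≤-Reasoning
      147k≤ : 147 * k ≤ 1026 * j + 847
      147k≤ = *-cancelˡ-≤ k {{>-nonZero 1≤k}} (begin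
        k * (147 * k)
          ≡⟨ rearrange₁ k ⟩
        147 * (k * k)
          ≤⟨ quadratic-bound j (λ b∈B → ≤-trans (B≤n b∈B) n≤3h) k≤ ≤-refl ⟩
        147 * (3 * (k * j)) + (585 * (k * j) + 847 * k)
          ≡⟨ rearrange₂ k j ⟩
        k * (1026 * j + 847) ∎)
        where
        rearrange₁ : ∀ k → k * (147 * k) ≡ 147 * (k * k)
        rearrange₁ = solve-∀
        rearrange₂ : ∀ k j → 147 * (3 * (k * j)) + (585 * (k * j) + 847 * k) ≡ k * (1026 * j + 847)
        rearrange₂ = solve-∀
      -- Linearises √k by (2j - 4)² ≥ 0.
      16j≤ : 16 * j ≤ k + 16
      16j≤ = begin
        16 * j                       ≡⟨ double j ⟩
        2 * 4 * (2 * j)              ≤⟨ m≤n+m _ (sq (2 * j) 4) ⟩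
        sq (2 * j) 4 + 2 * 4 * (2 * j) ≡⟨ sq-expand (2 * j) 4 ⟩
        2 * j * (2 * j) + 16         ≡⟨ cong (_+ 16) (square j) ⟩
        4 * (j * j) + 16             ≤⟨ +-monoˡ-≤ 16 ≤k ⟩
        k + 16                       ∎
        where
        double : ∀ j → 16 * j ≡ 2 * 4 * (2 * j)
        double = solve-∀
        square : ∀ j → 2 * j * (2 * j) ≡ 4 * (j * j)
        square = solve-∀
      82k≤1887 : 82 * k ≤ 1887
      82k≤1887 = +-cancelˡ-≤ (65 * k) _ _ (begin
        65 * k + 82 * k        ≡⟨ split k ⟩
        147 * k                ≤⟨ 147k≤ ⟩
        -- 1026 is rounded up to 1040 = 65 · 16; `1025 < 1040` unfolds to `1026 ≤ 1040`.
        1026 * j + 847         ≤⟨ +-monoˡ-≤ 847 (*-monoˡ-≤ j (<ᵇ⇒< 1025 1040 _)) ⟩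
        1040 * j + 847         ≡⟨ cong (_+ 847) (factor j) ⟩
        65 * (16 * j) + 847    ≤⟨ +-monoˡ-≤ 847 (*-monoʳ-≤ 65 16j≤) ⟩
        65 * (k + 16) + 847    ≡⟨ expand k ⟩
        65 * k + 1887          ∎)
        where
        split : ∀ k → 65 * k + 82 * k ≡ 147 * k
        split = solve-∀
        factor : ∀ j → 1040 * j ≡ 65 * (16 * j)
        factor = solve-∀
        expand : ∀ k → 65 * (k + 16) + 847 ≡ 65 * k + 1887
        expand = solve-∀

    -- Truncation makes this the positive part of k² - n - 23k.
    deficit : ℕ → ℕ
    deficit n = k * k ∸ (n + 23 * k)

    k≤23⇒deficit≡0 : ∀ n → k ≤ 23 → deficit n ≡ 0
    k≤23⇒deficit≡0 n k≤23 = m≤n⇒m∸n≡0 (≤-trans (*-monoˡ-≤ k k≤23) (m≤n+m (23 * k) n))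

    -- If j = 0 then k ≤ 3, and if n ≤ 3kj then k ≤ 23; in both cases 23k absorbs k². Otherwise
    -- `quadratic-bound` applies, with 847 ≤ 3381 = 147 · 23.
    deficit-bound : ∀ {n} j → (∀ {b} → b ∈ B → b ≤ n) →
      4 * (j * j) ≤ k → k ≤ 4 * (j * j) + 8 * j + 3 → 1 ≤ k →
      147 * deficit n ≤ 585 * (k * j)
    deficit-bound {n} zero B≤n ≤k k≤ 1≤k = 0-bound 147 (k≤23⇒deficit≡0 n (≤-trans k≤ (m≤m+n 3 20)))
    deficit-bound {n} j@(suc _) B≤n ≤k k≤ 1≤k with ≤-total n (3 * (k * j))
    ... | inj₁ n≤3h = 0-bound 147 (k≤23⇒deficit≡0 n (small-diameter⇒k≤23 j B≤n ≤k k≤ n≤3h 1≤k))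
    ... | inj₂ 3h≤n = begin
      147 * (k * k ∸ (n + 23 * k))               ≡⟨ *-distribˡ-∸ 147 (k * k) (n + 23 * k) ⟩
      147 * (k * k) ∸ 147 * (n + 23 * k)         ≤⟨ m≤n+o⇒m∸n≤o (147 * (k * k)) (147 * (n + 23 * k)) bound ⟩
      585 * (k * j)                              ∎
      where
      open ≤-Reasoning
      bound : 147 * (k * k) ≤ 147 * (n + 23 * k) + 585 * (k * j)
      bound = begin
        147 * (k * k)                               ≤⟨ quadratic-bound j B≤n k≤ 3h≤n ⟩
        147 * n + (585 * (k * j) + 847 * k)         ≤⟨ +-monoʳ-≤ (147 * n) (+-monoʳ-≤ (585 * (k * j)) (*-monoˡ-≤ k (<ᵇ⇒< 846 3381 _))) ⟩
        147 * n + (585 * (k * j) + 3381 * k)        ≡⟨ collect n k (k * j) ⟩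
        147 * (n + 23 * k) + 585 * (k * j)          ∎
        where
        collect : ∀ n k h → 147 * n + (585 * h + 3381 * k) ≡ 147 * (n + 23 * k) + 585 * h
        collect = solve-∀

  -- Translating a set of integers into ℕ.

  maxL-upper : ∀ {A a} → a ∈ A → a ℤ.≤ maxL A
  maxL-upper {a ∷ as} (here refl) = base as
    where
    base : ∀ as → a ℤ.≤ foldr ℤ._⊔_ a as
    base []       = ℤ.≤-refl
    base (b ∷ as) = ℤ.≤-trans (base as) (ℤ.i≤j⊔i b _)
  maxL-upper {a ∷ as} (there b∈as) = step b∈as
    where
    step : ∀ {b as} → b ∈ as → b ℤ.≤ foldr ℤ._⊔_ a as
    step {as = c ∷ as} (here refl)  = ℤ.i≤i⊔j c _
    step {as = c ∷ as} (there b∈as) = ℤ.≤-trans (step b∈as) (ℤ.i≤j⊔i c _)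

  minL-lower : ∀ {A a} → a ∈ A → minL A ℤ.≤ a
  minL-lower {a ∷ as} (here refl) = base as
    where
    base : ∀ as → foldr ℤ._⊓_ a as ℤ.≤ a
    base []       = ℤ.≤-refl
    base (b ∷ as) = ℤ.≤-trans (ℤ.i⊓j≤j b _) (base as)
  minL-lower {a ∷ as} (there b∈as) = step b∈as
    where
    step : ∀ {b as} → b ∈ as → foldr ℤ._⊓_ a as ℤ.≤ b
    step {as = c ∷ as} (here refl)  = ℤ.i⊓j≤i c _
    step {as = c ∷ as} (there b∈as) = ℤ.≤-trans (ℤ.i⊓j≤j c _) (step b∈as)

  shift : ℤ → ℕ → ℤ
  shift m b = m ℤ.+ ℤ.+ b

  cancel-sub : ∀ m x → m ℤ.+ (x ℤ.- m) ≡ x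
  cancel-sub = ℤSolver.solve-∀

  unshift : ∀ {m} A → All (m ℤ.≤_) A → ∃[ B ] A ≡ map (shift m) B
  unshift         []       []            = [] , refl
  unshift {m} (a ∷ as) (m≤a ∷ m≤as) with unshift as m≤as
  ... | B , refl = ℤ.∣ a ℤ.- m ∣ ∷ B , cong (_∷ map (shift m) B) (begin
    a                               ≡⟨ cancel-sub m a ⟨
    m ℤ.+ (a ℤ.- m)                 ≡⟨ cong (ℤ._+_ m) (ℤ.0≤i⇒+∣i∣≡i (ℤ.i≤j⇒0≤j-i m≤a)) ⟨
    m ℤ.+ ℤ.+ ℤ.∣ a ℤ.- m ∣         ∎)
    where open ≡-Reasoning

  shift-cancel-≤ : ∀ m {b n} → shift m b ℤ.≤ shift m n → b ≤ n
  shift-cancel-≤ m {b} {n} le = ℤ.drop‿+≤+ (subst₂ ℤ._≤_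
    (add-cancel m (ℤ.+ b)) (add-cancel m (ℤ.+ n)) (ℤ.+-monoˡ-≤ (ℤ.- m) le))
    where
    add-cancel : ∀ m x → m ℤ.+ x ℤ.+ ℤ.- m ≡ x
    add-cancel = ℤSolver.solve-∀

  shift-injective : ∀ m {b c} → shift m b ≡ shift m c → b ≡ c
  shift-injective m eq = ≤-antisym
    (shift-cancel-≤ m (ℤ.≤-reflexive eq)) (shift-cancel-≤ m (ℤ.≤-reflexive (sym eq)))

  -- Both differences are written with the common subtrahend b + d, so they agree once a + d = c +
  -- b.
  unshift-sidon : ∀ m B → IsSidon (map (shift m) B) → IsSidonℕ B
  unshift-sidon m B sidon {a} {b} {c} {d} a∈B b∈B c∈B d∈B a+d≡c+b
    with sidon (∈-map⁺ (shift m) a∈B) (∈-map⁺ (shift m) b∈B)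
               (∈-map⁺ (shift m) c∈B) (∈-map⁺ (shift m) d∈B) (begin
      shift m a ℤ.- shift m b                       ≡⟨ difference m (ℤ.+ a) (ℤ.+ b) (ℤ.+ d) ⟩
      ℤ.+ (a + d) ℤ.- (ℤ.+ b ℤ.+ ℤ.+ d)             ≡⟨ cong (λ e → ℤ.+ e ℤ.- (ℤ.+ b ℤ.+ ℤ.+ d)) a+d≡c+b ⟩
      ℤ.+ (c + b) ℤ.- (ℤ.+ b ℤ.+ ℤ.+ d)             ≡⟨ cong (ℤ._-_ (ℤ.+ (c + b))) (ℤ.+-comm (ℤ.+ b) (ℤ.+ d)) ⟩
      ℤ.+ (c + b) ℤ.- (ℤ.+ d ℤ.+ ℤ.+ b)             ≡⟨ difference m (ℤ.+ c) (ℤ.+ d) (ℤ.+ b) ⟨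
      shift m c ℤ.- shift m d                       ∎)
    where
    open ≡-Reasoning
    difference : ∀ m a b d → (m ℤ.+ a) ℤ.- (m ℤ.+ b) ≡ a ℤ.+ d ℤ.- (b ℤ.+ d)
    difference = ℤSolver.solve-∀
  ... | inj₁ (a≡b , c≡d) = inj₁ (shift-injective m a≡b , shift-injective m c≡d)
  ... | inj₂ (a≡c , b≡d) = inj₂ (shift-injective m a≡c , shift-injective m b≡d)

  -- Passing to the integer form of the bound.

  ⊖-form : ∀ k n → ℤ.+ k ℤ.* ℤ.+ k ℤ.- ℤ.+ n ℤ.- ℤ.+ 23 ℤ.* ℤ.+ k ≡ k * k ℤ.⊖ (n + 23 * k)
  ⊖-form k n = begin
    ℤ.+ k ℤ.* ℤ.+ k ℤ.- ℤ.+ n ℤ.- ℤ.+ 23 ℤ.* ℤ.+ k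
      ≡⟨ regroup (ℤ.+ k) (ℤ.+ n) ⟩
    ℤ.+ k ℤ.* ℤ.+ k ℤ.- (ℤ.+ n ℤ.+ ℤ.+ 23 ℤ.* ℤ.+ k)
      ≡⟨ cong₂ (λ e f → e ℤ.- (ℤ.+ n ℤ.+ f)) (ℤ.pos-* k k) (ℤ.pos-* 23 k) ⟨
    ℤ.+ (k * k) ℤ.- ℤ.+ (n + 23 * k)
      ≡⟨ ℤ.[+m]-[+n]≡m⊖n (k * k) (n + 23 * k) ⟩
    k * k ℤ.⊖ (n + 23 * k) ∎
    where
    open ≡-Reasoning
    regroup : ∀ k n → k ℤ.* k ℤ.- n ℤ.- ℤ.+ 23 ℤ.* k ≡ k ℤ.* k ℤ.- (n ℤ.+ ℤ.+ 23 ℤ.* k)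
    regroup = ℤSolver.solve-∀

  pos-inequality : ∀ C d k y → C * (y * y) ≤ d * d * (k * k * k) →
    ℤ.+ C ℤ.* (ℤ.+ y ℤ.* ℤ.+ y) ℤ.≤ (ℤ.+ d ℤ.* ℤ.+ d) ℤ.* (ℤ.+ k ℤ.* ℤ.+ k ℤ.* ℤ.+ k)
  pos-inequality C d k y bound = subst₂ ℤ._≤_ pos-lhs pos-rhs (ℤ.+≤+ bound)
    where
    pos-lhs : ℤ.+ (C * (y * y)) ≡ ℤ.+ C ℤ.* (ℤ.+ y ℤ.* ℤ.+ y)
    pos-lhs = trans (ℤ.pos-* C (y * y)) (cong (ℤ._*_ (ℤ.+ C)) (ℤ.pos-* y y))
    pos-rhs : ℤ.+ (d * d * (k * k * k)) ≡
              (ℤ.+ d ℤ.* ℤ.+ d) ℤ.* (ℤ.+ k ℤ.* ℤ.+ k ℤ.* ℤ.+ k)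
    pos-rhs = trans (ℤ.pos-* (d * d) (k * k * k)) (cong₂ ℤ._*_ (ℤ.pos-* d d)
      (trans (ℤ.pos-* (k * k) k) (cong (ℤ._* ℤ.+ k) (ℤ.pos-* k k))))

  square-bound : ∀ k j y → 4 * (j * j) ≤ k → 147 * y ≤ 585 * (k * j) →
    10000000000 * (y * y) ≤ 199058 * 199058 * (k * k * k)
  square-bound k j y ≤k y≤ = square-step k j 100000 199058 {10000000000} {y} refl ≤k
    -- The numerical core 585/294 ≤ 1.99058, checked as 58500000 ≤ 58523052.
    (linear-step 147 585 100000 199058 (k * j) {y} (≤ᵇ⇒≤ (100000 * 585) (147 * (199058 * 2)) _) y≤)

  ≤1·99058-bound : ∀ k j y → 4 * (j * j) ≤ k → 147 * y ≤ 585 * (k * j) →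
    ≤1·99058k^3/2 (ℤ.+ y) (ℤ.+ k)
  ≤1·99058-bound k j y ≤k y≤ =
    inj₂ (pos-inequality 10000000000 199058 k y (square-bound k j y ≤k y≤))

  -- A nonpositive difference falls under the first disjunct of the target; otherwise it equals the
  -- truncated one, and the squared inequality applies.
  ⊖-bound : ∀ k j N → 4 * (j * j) ≤ k → 147 * (k * k ∸ N) ≤ 585 * (k * j) →
    ≤1·99058k^3/2 (k * k ℤ.⊖ N) (ℤ.+ k)
  ⊖-bound k j N ≤k y≤ = [ below , above ]′ (≤-total (k * k) N)
    where
    below : k * k ≤ N → ≤1·99058k^3/2 (k * k ℤ.⊖ N) (ℤ.+ k)
    below k²≤N = inj₁ (subst (ℤ._≤ ℤ.+ 0) (sym (ℤ.⊖-≤ k²≤N)) ℤ.neg-≤-pos)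
    above : N ≤ k * k → ≤1·99058k^3/2 (k * k ℤ.⊖ N) (ℤ.+ k)
    above N≤k² = subst (λ x → ≤1·99058k^3/2 x (ℤ.+ k)) (sym (ℤ.⊖-≥ N≤k²))
      (≤1·99058-bound k j (k * k ∸ N) ≤k y≤)

  -- Stated for an arbitrary P, since rewriting inside the concrete predicate
  -- would unfold its large literals.
  transport : ∀ (P : ℤ → ℤ → Set) {A k n} → length A ≡ k → diam A ≡ ℤ.+ n →
    P (k * k ℤ.⊖ (n + 23 * k)) (ℤ.+ k) →
    P (ℤ.+ length A ℤ.* ℤ.+ length A ℤ.- diam A ℤ.- ℤ.+ 23 ℤ.* ℤ.+ length A) (ℤ.+ length A)
  transport P {A} {n = n} refl diam≡n p rewrite diam≡n =
    subst (λ x → P x (ℤ.+ length A)) (sym (⊖-form (length A) n)) p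

  -- The bound for Sidon sets of integers.

  diam-nonneg : ∀ A → length A ≥ 1 → ℤ.+ 0 ℤ.≤ diam A
  diam-nonneg A@(_ ∷ _) _ =
    ℤ.i≤j⇒0≤j-i (ℤ.≤-trans (minL-lower {A} (here refl)) (maxL-upper {A} (here refl)))

  -- Subtracting the minimum moves the set into [0, n] with `n` its diameter, preserving
  -- distinctness and the Sidon property.
  coordinates : ∀ A → length A ≥ 1 → Unique A → IsSidon A →
    ∃[ B ] ∃[ n ] length A ≡ length B × diam A ≡ ℤ.+ n ×
      Unique B × IsSidonℕ B × (∀ {b} → b ∈ B → b ≤ n)
  coordinates A 1≤k A-unique A-sidon with unshift {minL A} A (All.tabulate minL-lower)
  ... | B , A≡ =
    B , n , trans (cong length A≡) (length-map (shift m) B) , diam≡n ,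
    Unique.map⁻ (subst Unique A≡ A-unique) ,
    unshift-sidon m B (subst IsSidon A≡ A-sidon) ,
    λ {b} b∈B → shift-cancel-≤ m (subst (shift m b ℤ.≤_) maxL≡
      (maxL-upper (subst (shift m b ∈_) (sym A≡) (∈-map⁺ (shift m) b∈B))))
    where
    m = minL A
    n = ℤ.∣ diam A ∣
    diam≡n : diam A ≡ ℤ.+ n
    diam≡n = sym (ℤ.0≤i⇒+∣i∣≡i (diam-nonneg A 1≤k))
    maxL≡ : maxL A ≡ shift m n
    maxL≡ = trans (sym (cancel-sub m (maxL A))) (cong (ℤ._+_ m) diam≡n)

  sidon-bound : ∀ A → Unique A → IsSidon A → length A ≥ 1 →
    ≤1·99058k^3/2 (ℤ.+ length A ℤ.* ℤ.+ length A ℤ.- diam A ℤ.- ℤ.+ 23 ℤ.* ℤ.+ length A) (ℤ.+ length A)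
  sidon-bound A A-unique A-sidon 1≤k =
    let B , n , k≡ , diam≡n , B-unique , B-sidon , B≤n = coordinates A 1≤k A-unique A-sidon
        j , ≤k , k≤ = half-sqrt (length B)
    in transport ≤1·99058k^3/2 {A} k≡ diam≡n
         (⊖-bound (length B) j (n + 23 * length B) ≤k
           (deficit-bound B B-unique B-sidon j B≤n ≤k k≤ (subst (1 ≤_) k≡ 1≤k)))

open import Data.Nat using (ℕ; _≥_)
open import Data.Integer using (ℤ; +_; _-_; _*_)

theorem2 : ∃[ C ] ((A : List ℤ) → Unique A → IsSidon A → length A ≥ 1 →
    ≤1·99058k^3/2 (+ length A * + length A - diam A - + C * + length A) (+ length A))
-- The constant 23 is the size threshold of `small-diameter⇒k≤23`, and it also covers the linear
-- term 847k/147.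
theorem2 = 23 , Bounds.sidon-bound
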